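{- Let $k\ge 1$ and $r\ge 2$ be integers, and let $T$ be a tree on $k+1$ vertices with maximum degree $\Delta(T)$. If $k \le r$, then for every positive integer $n$, \[\mathrm{ex}_r(n,\text{Berge- }T) \leq (\Delta(T)-1)n.\]
   Context: All graphs and hypergraphs are finite and simple. A hypergraph $\mathcal{H}$ contains a Berge-$F$ (Berge copy of the graph $F$) if there are an injection $\varphi:V(F)\to V(\mathcal{H})$ and an injection $f:E(F)\to E(\mathcal{H})$ with $\{\varphi(u),\varphi(v)\}\subset f(uv)$ for every edge $uv\in E(F)$; otherwise it is Berge-$F$-free. $\mathrm{ex}_r(n,\text{Berge- }F)$ is the maximum number of hyperedges in an $n$-vertex $r$-uniform Berge-$F$-free hypergraph. -}

module Defs where

open import Data.Bool.Base using (Bool; true; false)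
import Data.Bool.Properties as Bool
open import Data.Empty using (⊥-elim)
open import Data.Fin.Base using (Fin; zero; suc; inject₁; fromℕ; combine)
import Data.Fin.Base as Fin
import Data.Fin.Properties as Fin
open import Data.Fin.Subset using (Subset; ⁅_⁆; _∪_; _⊆_; ∣_∣)
open import Data.Fin.Subset.Properties using (_⊆?_; anySubset?)
open import Data.List.Base
  using (List; []; _∷_; length; lookup; map; filter; allFin; cartesianProduct)
open import Data.List.Extrema.Nat using (max)
open import Data.List.Membership.Propositional.Properties using (∈-lookup)
open import Data.List.Relation.Unary.All using (All; []; all?)
import Data.List.Relation.Unary.All as All
open import Data.List.Relation.Unary.AllPairs using ([]; _∷_)
open import Data.List.Relation.Unary.Unique.Propositional using (Unique)
import Data.List.Relation.Unary.Unique.DecPropositional as DecUnique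
open import Data.Nat.Base using (ℕ; zero; suc; _≤_; _<_; _^_; z≤n; s≤s)
import Data.Nat.Properties as ℕ
open import Data.Product.Base using (∃; _×_; _,_; proj₁; proj₂)
open import Data.Vec.Base using ([]; _∷_)
open import Data.Vec.Functional using () renaming (_∷_ to _∷ᶠ_)
import Data.Vec.Properties as Vec
open import Function.Base using (_∘_)
open import Function.Definitions using (Injective)
open import Level using (0ℓ)
open import Relation.Binary.Construct.Closure.ReflexiveTransitive using (Star)
open import Relation.Binary.Core using (Rel)
import Relation.Binary.Definitions as B
open import Relation.Binary.PropositionalEquality
  using (_≡_; _≗_; refl; sym; trans; cong; cong₂; subst)
open import Relation.Nullary using (¬_; Dec; yes; no)
open import Relation.Nullary.Decidable using (map′; ¬?; _×-dec_; _→-dec_)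
open import Relation.Unary using (Decidable)

record Graph (v : ℕ) : Set₁ where
  field
    Adj    : Rel (Fin v) 0ℓ
    adj?   : B.Decidable Adj
    symm   : B.Symmetric Adj
    irrefl : ∀ {x} → ¬ Adj x x

-- Each edge {x , y} is listed exactly once, as the pair with x < y.
edges : ∀ {v} → Graph v → List (Fin v × Fin v)
edges {v} G =
  filter (λ (x , y) → (x Fin.<? y) ×-dec adj? x y)
         (cartesianProduct (allFin v) (allFin v))
  where open Graph G

degree : ∀ {v} → Graph v → Fin v → ℕ
degree {v} G x = length (filter (adj? x) (allFin v))
  where open Graph G

maxDegree : ∀ {v} → Graph v → ℕ
maxDegree {v} G = max 0 (map (degree G) (allFin v))

Connected : ∀ {v} → Graph v → Set
Connected G = ∀ x y → Star (Graph.Adj G) x y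

-- A cycle c₀ c₁ … c_ℓ c₀ through ℓ + 1 ≥ 3 distinct vertices.
record Cycle {v} (G : Graph v) : Set where
  open Graph G
  field
    {ℓ}      : ℕ
    2≤ℓ      : 2 ≤ ℓ
    c        : Fin (suc ℓ) → Fin v
    distinct : Injective _≡_ _≡_ c
    step     : ∀ (i : Fin ℓ) → Adj (c (inject₁ i)) (c (suc i))
    close    : Adj (c (fromℕ ℓ)) (c zero)

record IsTree {k} (G : Graph (suc k)) : Set where
  field
    connected : Connected G
    acyclic   : ¬ Cycle G

record Hypergraph (n : ℕ) : Set where
  field
    hyperedges : List (Subset n)
    simple     : Unique hyperedges

open Hypergraph public

size : ∀ {n} → Hypergraph n → ℕ
size H = length (hyperedges H)

Uniform : ∀ {n} → ℕ → Hypergraph n → Set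
Uniform r H = All (λ e → ∣ e ∣ ≡ r) (hyperedges H)

-- Edges and hyperedges are addressed by their positions in the
-- (repetition-free) lists `edges F` and `hyperedges H`.
record BergeCopy {v n} (F : Graph v) (H : Hypergraph n) : Set where
  field
    φ           : Fin v → Fin n
    φ-injective : Injective _≡_ _≡_ φ
    f           : Fin (length (edges F)) → Fin (size H)
    f-injective : Injective _≡_ _≡_ f
    covers      : ∀ i → let (x , y) = lookup (edges F) i in
                  ⁅ φ x ⁆ ∪ ⁅ φ y ⁆ ⊆ lookup (hyperedges H) (f i)

BergeFree : ∀ {v n} → Graph v → Hypergraph n → Set
BergeFree F H = ¬ BergeCopy F H

Admissible : ∀ {v n} → ℕ → Graph v → Hypergraph n → Set
Admissible r F H = Uniform r H × BergeFree F H

private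
  -- P must respect ≗, in the absence of function extensionality.
  any-fun? : ∀ m {n} {P : (Fin m → Fin n) → Set} →
             (∀ {g h} → g ≗ h → P g → P h) → Decidable P → Dec (∃ P)
  any-fun? zero    ext P? =
    map′ (λ p → _ , p) (λ (_ , p) → ext (λ ()) p) (P? (λ ()))
  any-fun? (suc m) ext P? =
    map′ (λ (a , g , p) → (a ∷ᶠ g) , p)
         (λ (h , p) → h zero , h ∘ suc ,
                      ext (λ { zero → refl ; (suc _) → refl }) p)
         (Fin.any? λ a → any-fun? m
            (λ eq → ext λ { zero → refl ; (suc i) → eq i })
            (λ g → P? (a ∷ᶠ g)))

  Injective′ : ∀ {m n} → (Fin m → Fin n) → Set
  Injective′ g = ∀ x y → g x ≡ g y → x ≡ y

  injective′? : ∀ {m n} (g : Fin m → Fin n) → Dec (Injective′ g)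
  injective′? g =
    Fin.all? λ x → Fin.all? λ y → (g x Fin.≟ g y) →-dec (x Fin.≟ y)

  injective′-ext : ∀ {m n} {g h : Fin m → Fin n} → g ≗ h →
                   Injective′ g → Injective′ h
  injective′-ext eq inj x y hx≡hy =
    inj x y (trans (eq x) (trans hx≡hy (sym (eq y))))

  any-list? : ∀ {n} m {P : List (Subset n) → Set} → Decidable P →
              Dec (∃ λ E → length E ≡ m × P E)
  any-list? zero    P? =
    map′ (λ p → [] , refl , p) (λ { ([] , _ , p) → p }) (P? [])
  any-list? (suc m) P? =
    map′ (λ (e , E , eq , p) → e ∷ E , cong suc eq , p)
         (λ { (e ∷ E , eq , p) → e , E , ℕ.suc-injective eq , p })
         (anySubset? λ e → any-list? m (λ E → P? (e ∷ E)))

bergeCopy? : ∀ {v n} (F : Graph v) (H : Hypergraph n) → Dec (BergeCopy F H)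
bergeCopy? {v} {n} F H =
  map′ (λ (φ , φ-inj , f , f-inj , cov) → record
          { φ = φ ; φ-injective = φ-inj _ _
          ; f = f ; f-injective = f-inj _ _ ; covers = cov })
       (λ b → let open BergeCopy b in
          φ , (λ _ _ → φ-injective) , f , (λ _ _ → f-injective) , covers)
       (any-fun? v
          (λ eq (inj , f , f-inj , cov) →
             injective′-ext eq inj , f , f-inj , λ i →
             subst (_⊆ lookup (hyperedges H) (f i))
                   (cong₂ (λ a b → ⁅ a ⁆ ∪ ⁅ b ⁆) (eq _) (eq _)) (cov i))
          (λ φ → injective′? φ ×-dec
             any-fun? (length (edges F))
               (λ eq (inj , cov) → injective′-ext eq inj , λ i →
                  subst (Covers φ i) (eq i) (cov i))
               (λ f → injective′? f ×-dec Fin.all? (λ i → covers? φ i (f i)))))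
  where
  Covers : (Fin v → Fin n) → Fin (length (edges F)) → Fin (size H) → Set
  Covers φ i j = let (x , y) = lookup (edges F) i in
                 ⁅ φ x ⁆ ∪ ⁅ φ y ⁆ ⊆ lookup (hyperedges H) j

  covers? : ∀ φ i j → Dec (Covers φ i j)
  covers? φ i j = _ ⊆? _

admissible? : ∀ {v n} r (F : Graph v) (H : Hypergraph n) → Dec (Admissible r F H)
admissible? r F H =
  all? (λ e → ∣ e ∣ ℕ.≟ r) (hyperedges H) ×-dec ¬? (bergeCopy? F H)

AdmissibleSize : ∀ {v} → ℕ → ℕ → Graph v → ℕ → Set
AdmissibleSize r n F m =
  ∃ λ (H : Hypergraph n) → size H ≡ m × Admissible r F H

admissibleSize? : ∀ {v} r n (F : Graph v) → Decidable (AdmissibleSize r n F)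
admissibleSize? r n F m =
  map′ (λ (E , eq , u , a) → record { hyperedges = E ; simple = u } , eq , a)
       (λ (H , eq , a) → hyperedges H , eq , simple H , a)
       (any-list? m test)
  where
  open DecUnique (Vec.≡-dec {n = n} Bool._≟_) using (unique?)
  test : Decidable (λ E → ∃ λ (u : Unique E) →
                    Admissible r F (record { hyperedges = E ; simple = u }))
  test E with unique? E
  ... | no ¬u = no (¬u ∘ proj₁)
  ... | yes u = map′ (u ,_)
    (λ (_ , unif , free) → unif , λ b → free (record { BergeCopy b }))
    (admissible? r F _)

-- The largest m ≤ b satisfying P, and 0 if there is none.
greatest : ∀ {P : ℕ → Set} → Decidable P → ℕ → ℕ
greatest P? zero    = zero
greatest P? (suc b) with P? (suc b)
... | yes _ = suc b
... | no  _ = greatest P? b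

-- The Turán number.  A simple hypergraph on n vertices has at most 2 ^ n
-- hyperedges (`size≤2^n`), so the search is exhaustive.  The
-- lemmas `ex-upper` and `ex-attained` show that this is the maximum, the
-- only exception being an edgeless F, for which there may be no
-- Berge-F-free hypergraph at all.
ex : ∀ {v} → ℕ → ℕ → Graph v → ℕ
ex r n F = greatest (admissibleSize? r n F) (2 ^ n)

greatest-upper : ∀ {P : ℕ → Set} (P? : Decidable P) b {m} →
                 P m → m ≤ b → m ≤ greatest P? b
greatest-upper P? zero    p m≤b = m≤b
greatest-upper P? (suc b) p m≤b with P? (suc b)
... | yes _ = m≤b
... | no ¬p = greatest-upper P? b p
                (ℕ.≤-pred (ℕ.≤∧≢⇒< m≤b λ { refl → ¬p p }))

greatest-attained : ∀ {P : ℕ → Set} (P? : Decidable P) b →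
                    P 0 → P (greatest P? b)
greatest-attained P? zero    p₀ = p₀
greatest-attained P? (suc b) p₀ with P? (suc b)
... | yes p = p
... | no  _ = greatest-attained P? b p₀

private
  encode : ∀ {n} → Subset n → Fin (2 ^ n)
  encode []      = zero
  encode (b ∷ s) = combine (bit b) (encode s)
    where
    bit : Bool → Fin 2
    bit false = zero
    bit true  = suc zero

  encode-injective : ∀ {n} → Injective _≡_ _≡_ (encode {n})
  encode-injective {x = []}        {[]}        eq = refl
  encode-injective {x = true  ∷ s} {true  ∷ t} eq =
    cong (true ∷_) (encode-injective (Fin.combine-injectiveʳ {2} (suc zero) (encode s) (suc zero) (encode t) eq))
  encode-injective {x = false ∷ s} {false ∷ t} eq =
    cong (false ∷_) (encode-injective (Fin.combine-injectiveʳ {2} zero (encode s) zero (encode t) eq))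
  encode-injective {x = true  ∷ s} {false ∷ t} eq
    with () ← Fin.combine-injectiveˡ {2} (suc zero) (encode s) zero (encode t) eq
  encode-injective {x = false ∷ s} {true  ∷ t} eq
    with () ← Fin.combine-injectiveˡ {2} zero (encode s) (suc zero) (encode t) eq

lookup-injective : ∀ {A : Set} {xs : List A} → Unique xs →
                   Injective _≡_ _≡_ (lookup xs)
lookup-injective (_  ∷ _) {zero}  {zero}  eq = refl
lookup-injective (x≢ ∷ _) {zero}  {suc j} eq =
  ⊥-elim (All.lookup x≢ (∈-lookup j) eq)
lookup-injective (x≢ ∷ _) {suc i} {zero}  eq =
  ⊥-elim (All.lookup x≢ (∈-lookup i) (sym eq))
lookup-injective (_  ∷ u) {suc i} {suc j} eq =
  cong suc (lookup-injective u eq)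

size≤2^n : ∀ {n} (H : Hypergraph n) → size H ≤ 2 ^ n
size≤2^n H = Fin.injective⇒≤ {f = encode ∘ lookup (hyperedges H)}
  (lookup-injective (simple H) ∘ encode-injective)

ex-upper : ∀ {v} r n (F : Graph v) (H : Hypergraph n) →
           Uniform r H → BergeFree F H → size H ≤ ex r n F
ex-upper r n F H unif free =
  greatest-upper (admissibleSize? r n F) (2 ^ n) (H , refl , unif , free)
                 (size≤2^n H)

ex-attained : ∀ {v} r n (F : Graph v) → 0 < length (edges F) →
              ∃ λ (H : Hypergraph n) →
              size H ≡ ex r n F × Uniform r H × BergeFree F H
ex-attained r n F 0<e =
  greatest-attained (admissibleSize? r n F) (2 ^ n)
    (record { hyperedges = [] ; simple = [] } , refl , [] , free)
  where
  free : BergeFree F (record { hyperedges = [] ; simple = [] })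
  free b with () ← BergeCopy.f b (Fin.fromℕ< 0<e)

{-# OPTIONS --safe #-}

-- Write d = Δ(T) - 1, assign every hyperedge to one of its vertices, and call
-- the number of hyperedges assigned to a vertex its load.  With more than d n
-- hyperedges some vertex u₀ has load greater than d.  Let u reach every vertex
-- of every hyperedge assigned to u.  If u₀ reaches a vertex of load less than
-- d, moving hyperedges along the path lowers the total deficit Σ (d ∸ load);
-- hence, when this is minimal, all vertices reachable from u₀ have load at
-- least d.  Then T embeds greedily with its root at u₀, the edges from a vertex
-- to its children being represented by hyperedges assigned to its image.  A
-- hyperedge has r ≥ k vertices, so it has an unused one except possibly at the
-- last step, where exchanging two hyperedges helps (see `embedLast`).

module Submission where

open import Defs
open import Data.Empty using (⊥; ⊥-elim)
import Data.Fin.Base as Fin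
open import Data.Fin.Base using (Fin; zero; suc; inject₁; fromℕ)
import Data.Fin.Properties as Fin
open import Data.Fin.Subset using (Subset; inside; outside; ∣_∣; _∪_; ⁅_⁆)
  renaming (_∈_ to _∈ˢ_; _∉_ to _∉ˢ_; _⊆_ to _⊆ˢ_)
import Data.Fin.Subset.Properties as Subset
open import Data.List.Base
  using (List; []; _∷_; length; lookup; map; filter; allFin; concatMap; cartesianProduct)
import Data.List.Extrema.Nat as Extrema
import Data.List.Membership.DecPropositional as DecMembership
open import Data.List.Membership.Propositional using (_∈_; _∉_; find; lose)
open import Data.List.Membership.Propositional.Properties
  using (∈-allFin; ∈-cartesianProduct⁺; ∈-concatMap⁺; ∈-filter⁺; ∈-filter⁻; ∈-length;
         ∈-lookup; ∈-map⁺; ∈-map⁻)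
import Data.List.Properties as List
open import Data.List.Relation.Binary.Subset.Propositional using (_⊆_)
import Data.List.Relation.Unary.All as All
open import Data.List.Relation.Unary.All.Properties using (¬Any⇒All¬)
import Data.List.Relation.Unary.Any as Any
open import Data.List.Relation.Unary.Any using (here; there; index; any?)
open import Data.List.Relation.Unary.Any.Properties using (lookup-index)
open import Data.List.Relation.Unary.AllPairs using ([]; _∷_)
open import Data.List.Relation.Unary.All using ([]; _∷_)
open import Data.List.Relation.Unary.Unique.Propositional using (Unique)
import Data.List.Relation.Unary.Unique.Propositional.Properties as Unique
open import Data.Nat.Base using (ℕ; zero; suc; _≤_; _<_; _∸_; _*_; z≤n; s≤s)
open import Data.Nat.Induction using (<-rec)
open import Data.Nat.ListAction using (sum)
import Data.Nat.Properties as ℕ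
open import Data.Product.Base using (∃; Σ; _×_; _,_; proj₁; proj₂)
open import Data.Sum.Base using (_⊎_; inj₁; inj₂)
open import Data.Vec.Base using ([]; _∷_) renaming (here to hereᵛ; there to thereᵛ)
open import Data.Vec.Functional using (updateAt)
open import Data.Vec.Functional.Properties using (updateAt-updates; updateAt-minimal)
open import Function.Base using (_∘_; const; id)
open import Relation.Binary.Construct.Closure.ReflexiveTransitive
  using (Star; ε; _◅_; _◅◅_)
import Relation.Binary.Construct.Closure.ReflexiveTransitive as Star
open import Relation.Binary.Definitions using (tri<; tri≈; tri>)
open import Relation.Binary.PropositionalEquality
  using (_≡_; _≢_; refl; sym; trans; cong; subst)
open import Relation.Nullary using (¬_; yes; no)
open import Relation.Nullary.Decidable using (¬?; _×-dec_)
open import Relation.Nullary.Negation using (contradiction)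

-- Counting in repetition-free lists and finite subsets

unique-⊆⇒length≤ : ∀ {A : Set} {xs ys : List A} →
                   Unique xs → xs ⊆ ys → length xs ≤ length ys
unique-⊆⇒length≤ {xs = xs} {ys} u xs⊆ys = Fin.injective⇒≤ {f = position} inj
  where
  position : Fin (length xs) → Fin (length ys)
  position i = index (xs⊆ys (∈-lookup i))
  inj : ∀ {i j} → position i ≡ position j → i ≡ j
  inj {i} {j} eq = lookup-injective u
    (trans (lookup-index (xs⊆ys (∈-lookup i)))
    (trans (cong (lookup ys) eq) (sym (lookup-index (xs⊆ys (∈-lookup j))))))

unique-∷ : ∀ {A : Set} {x : A} {xs} → x ∉ xs → Unique xs → Unique (x ∷ xs)
unique-∷ {xs = xs} x∉xs u = ¬Any⇒All¬ xs x∉xs ∷ u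

module _ {n : ℕ} where
  open DecMembership (Fin._≟_ {n}) using (_∈?_) public

fresh : ∀ {n} {xs ys : List (Fin n)} → Unique xs → length ys < length xs →
        ∃ λ x → x ∈ xs × x ∉ ys
fresh {xs = xs} {ys} u ys<xs with any? (λ x → ¬? (x ∈? ys)) xs
... | yes p = let x , x∈ , x∉ = find p in x , x∈ , x∉
... | no ¬p = contradiction (unique-⊆⇒length≤ u xs⊆ys) (ℕ.<⇒≱ ys<xs)
  where
  xs⊆ys : xs ⊆ ys
  xs⊆ys {x} x∈xs with x ∈? ys
  ... | yes x∈ys = x∈ys
  ... | no  x∉ys = ⊥-elim (¬p (Any.map (λ { refl → x∉ys }) x∈xs))

elements : ∀ {n} → Subset n → List (Fin n)
elements []            = []
elements (inside  ∷ p) = zero ∷ map suc (elements p)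
elements (outside ∷ p) = map suc (elements p)

length-elements : ∀ {n} (p : Subset n) → length (elements p) ≡ ∣ p ∣
length-elements []            = refl
length-elements (inside  ∷ p) =
  cong suc (trans (List.length-map suc (elements p)) (length-elements p))
length-elements (outside ∷ p) =
  trans (List.length-map suc (elements p)) (length-elements p)

elements-unique : ∀ {n} (p : Subset n) → Unique (elements p)
elements-unique []            = []
elements-unique (inside  ∷ p) = unique-∷ zero∉ (Unique.map⁺ Fin.suc-injective (elements-unique p))
  where
  zero∉ : zero ∉ map suc (elements p)
  zero∉ z with () ← proj₂ (proj₂ (∈-map⁻ suc z))
elements-unique (outside ∷ p) = Unique.map⁺ Fin.suc-injective (elements-unique p)

∈-elements : ∀ {n} (p : Subset n) {x} → x ∈ elements p → x ∈ˢ p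
∈-elements (inside  ∷ p) (here refl) = hereᵛ
∈-elements (inside  ∷ p) (there x∈) with ∈-map⁻ suc x∈
... | y , y∈ , refl = thereᵛ (∈-elements p y∈)
∈-elements (outside ∷ p) x∈ with ∈-map⁻ suc x∈
... | y , y∈ , refl = thereᵛ (∈-elements p y∈)

freshElement : ∀ {n} (p : Subset n) {ys} → length ys < ∣ p ∣ →
               ∃ λ x → x ∈ˢ p × x ∉ ys
freshElement p ys<p
  with x , x∈ , x∉ ← fresh (elements-unique p)
                       (subst (_ <_) (sym (length-elements p)) ys<p)
  = x , ∈-elements p x∈ , x∉

-- A member `y` of `ys` outside `p` would extend `elements p` to a repetition-free list inside `ys`
-- that is longer than `ys`.
covered⇒exhausts : ∀ {n} (p : Subset n) {ys} → length ys ≤ ∣ p ∣ →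
                   (∀ {x} → x ∈ˢ p → x ∈ ys) → ∀ {y} → y ∈ ys → y ∈ˢ p
covered⇒exhausts p {ys} ys≤p p⊆ys {y} y∈ys with y Subset.∈? p
... | yes y∈p = y∈p
... | no  y∉p = contradiction
  (unique-⊆⇒length≤ (unique-∷ (y∉p ∘ ∈-elements p) (elements-unique p)) ⊆ys)
  (ℕ.<⇒≱ (s≤s (ℕ.≤-trans ys≤p (ℕ.≤-reflexive (sym (length-elements p))))))
  where
  ⊆ys : y ∷ elements p ⊆ ys
  ⊆ys (here refl) = y∈ys
  ⊆ys (there x∈)  = p⊆ys (∈-elements p x∈)

difference : ∀ {n} (p q : Subset n) → ∣ q ∣ ≤ ∣ p ∣ → p ≢ q →
             ∃ λ x → x ∈ˢ p × x ∉ˢ q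
difference p q q≤p p≢q
  with Fin.any? (λ x → (x Subset.∈? p) ×-dec ¬? (x Subset.∈? q))
... | yes r = r
... | no ¬r = contradiction (Subset.⊆-antisym p⊆q q⊆p) p≢q
  where
  p⊆q : p ⊆ˢ q
  p⊆q {x} x∈p with x Subset.∈? q
  ... | yes x∈q = x∈q
  ... | no  x∉q = ⊥-elim (¬r (x , x∈p , x∉q))
  q⊆p : q ⊆ˢ p
  q⊆p {x} x∈q with x Subset.∈? p
  ... | yes x∈p = x∈p
  ... | no  x∉p = contradiction q≤p
    (ℕ.<⇒≱ (Subset.p⊂q⇒∣p∣<∣q∣ (p⊆q , x , x∈q , x∉p)))

-- Sums and truncated subtraction

sum-map-≤ : ∀ {A : Set} {f g : A → ℕ} → (∀ x → f x ≤ g x) →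
            ∀ xs → sum (map f xs) ≤ sum (map g xs)
sum-map-≤ f≤g []       = z≤n
sum-map-≤ f≤g (x ∷ xs) = ℕ.+-mono-≤ (f≤g x) (sum-map-≤ f≤g xs)

sum-map-< : ∀ {A : Set} {f g : A → ℕ} → (∀ x → f x ≤ g x) →
            ∀ {x xs} → x ∈ xs → f x < g x → sum (map f xs) < sum (map g xs)
sum-map-< f≤g {xs = _ ∷ xs} (here refl) f<g = ℕ.+-mono-<-≤ f<g (sum-map-≤ f≤g xs)
sum-map-< f≤g (there x∈)  f<g = ℕ.+-mono-≤-< (f≤g _) (sum-map-< f≤g x∈ f<g)

-- When `b` exceeds `d` the left side truncates to 0, while `a < d` keeps the right side positive.
∸-monoʳ-<-unbounded : ∀ {d a b} → a < d → a < b → d ∸ b < d ∸ a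
∸-monoʳ-<-unbounded {d} {a} {b} a<d a<b with b ℕ.≤? d
... | yes b≤d = ℕ.∸-monoʳ-< a<b b≤d
... | no  b≰d rewrite ℕ.m≤n⇒m∸n≡0 (ℕ.≰⇒≥ b≰d) = ℕ.m<n⇒0<n∸m a<d

length-concatMap-≤ : ∀ {A B : Set} (f : A → List B) {d} xs →
                     (∀ x → length (f x) ≤ d) →
                     length (concatMap f xs) ≤ length xs * d
length-concatMap-≤ f []       f≤d = z≤n
length-concatMap-≤ f (x ∷ xs) f≤d = ℕ.≤-trans
  (ℕ.≤-reflexive (List.length-++ (f x)))
  (ℕ.+-mono-≤ (f≤d x) (length-concatMap-≤ f xs f≤d))

-- Assignments of the hyperedges to their own vertices

module Assignments {n m : ℕ} (e : Fin m → Subset n) where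

  Assignment : Set
  Assignment = Σ (Fin m → Fin n) λ a → ∀ i → a i ∈ˢ e i

  owned : (Fin m → Fin n) → Fin n → List (Fin m)
  owned a v = filter (λ i → a i Fin.≟ v) (allFin m)

  owned-unique : ∀ a v → Unique (owned a v)
  owned-unique a v = Unique.filter⁺ _ (Unique.allFin⁺ m)

  ∈-owned⁺ : ∀ a {v i} → a i ≡ v → i ∈ owned a v
  ∈-owned⁺ a {i = i} eq = ∈-filter⁺ (λ i → a i Fin.≟ _) (∈-allFin i) eq

  ∈-owned⁻ : ∀ a {v i} → i ∈ owned a v → a i ≡ v
  ∈-owned⁻ a i∈ = proj₂ (∈-filter⁻ (λ i → a i Fin.≟ _) {xs = allFin m} i∈)

  load : (Fin m → Fin n) → Fin n → ℕ
  load a v = length (owned a v)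

  -- Pigeonhole: the lists `owned a v` together contain all `m` hyperedges, so they cannot all have
  -- length at most `d`.
  overloaded : ∀ a {d} → d * n < m → ∃ λ v → d < load a v
  overloaded a {d} dn<m with Fin.any? (λ v → d ℕ.<? load a v)
  ... | yes p = p
  ... | no ¬p = contradiction m≤dn (ℕ.<⇒≱ dn<m)
    where
    open ℕ.≤-Reasoning
    all-owned : allFin m ⊆ concatMap (owned a) (allFin n)
    all-owned {i} _ = ∈-concatMap⁺ (owned a)
      (Any.map (λ { refl → ∈-owned⁺ a refl }) (∈-allFin (a i)))
    m≤dn : m ≤ d * n
    m≤dn = begin
      m                                        ≡⟨ List.length-tabulate (id {A = Fin m}) ⟨
      length (allFin m)                        ≤⟨ unique-⊆⇒length≤ (Unique.allFin⁺ m) all-owned ⟩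
      length (concatMap (owned a) (allFin n))  ≤⟨ length-concatMap-≤ (owned a) (allFin n)
                                                    (λ v → ℕ.≮⇒≥ (λ lt → ¬p (v , lt))) ⟩
      length (allFin n) * d                    ≡⟨ cong (_* d) (List.length-tabulate (id {A = Fin n})) ⟩
      n * d                                    ≡⟨ ℕ.*-comm n d ⟩
      d * n                                    ∎

  Step : (Fin m → Fin n) → Fin n → Fin n → Set
  Step a u w = ∃ λ i → a i ≡ u × w ∈ˢ e i

  Reach : (Fin m → Fin n) → Fin n → Fin n → Set
  Reach a = Star (Step a)

  length⋆ : ∀ {a u w} → Reach a u w → ℕ
  length⋆ = Star.fold (λ _ _ → ℕ) (λ _ → suc) 0

  module Move (a : Fin m → Fin n) (i : Fin m) (w : Fin n) where

    moved : Fin m → Fin n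
    moved = updateAt a i (const w)

    moved-at : moved i ≡ w
    moved-at = updateAt-updates i a

    moved-off : ∀ {j} → j ≢ i → moved j ≡ a j
    moved-off j≢i = updateAt-minimal _ i a j≢i

    load-other : ∀ {x} → x ≢ a i → load a x ≤ load moved x
    load-other x≢ = unique-⊆⇒length≤ (owned-unique a _) λ {j} j∈ →
      let aj≡x = ∈-owned⁻ a j∈ in
      ∈-owned⁺ moved (trans (moved-off λ { refl → x≢ (sym aj≡x) }) aj≡x)

    load-target : w ≢ a i → load a w < load moved w
    load-target w≢ = unique-⊆⇒length≤
      (unique-∷ (λ i∈ → w≢ (sym (∈-owned⁻ a i∈))) (owned-unique a _)) sub
      where
      sub : i ∷ owned a w ⊆ owned moved w
      sub (here refl) = ∈-owned⁺ moved moved-at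
      sub {j} (there j∈) = let aj≡w = ∈-owned⁻ a j∈ in
        ∈-owned⁺ moved (trans (moved-off λ { refl → w≢ (sym aj≡w) }) aj≡w)

    load-source : load a (a i) ≤ suc (load moved (a i))
    load-source = unique-⊆⇒length≤ (owned-unique a _) sub
      where
      sub : owned a (a i) ⊆ i ∷ owned moved (a i)
      sub {j} j∈ with j Fin.≟ i
      ... | yes refl = here refl
      ... | no  j≢i  = there (∈-owned⁺ moved (trans (moved-off j≢i) (∈-owned⁻ a j∈)))

    load-nontarget : ∀ {x} → x ≢ w → load moved x ≤ load a x
    load-nontarget x≢w = unique-⊆⇒length≤ (owned-unique moved _) sub
      where
      sub : owned moved _ ⊆ owned a _
      sub {j} j∈ with j Fin.≟ i
      ... | yes refl = ⊥-elim (x≢w (trans (sym (∈-owned⁻ moved j∈)) moved-at))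
      ... | no  j≢i  = ∈-owned⁺ a (trans (sym (moved-off j≢i)) (∈-owned⁻ moved j∈))

    -- A path either avoids i and survives the move, or passes through i,
    -- and then its part from i onwards starts at the old owner of i.
    reroute : ∀ {x u} (s : Reach a x u) →
              (Σ (Reach moved x u) λ s′ → length⋆ s′ ≤ length⋆ s) ⊎
              (Σ (Reach a (a i) u) λ s′ → length⋆ s′ ≤ length⋆ s)
    reroute ε = inj₁ (ε , z≤n)
    reroute ((j , refl , y∈) ◅ s) with j Fin.≟ i
    ... | yes refl = inj₂ ((j , refl , y∈) ◅ s , ℕ.≤-refl)
    ... | no  j≢i with reroute s
    ...   | inj₁ (s′ , le) = inj₁ ((j , moved-off j≢i , y∈) ◅ s′ , s≤s le)
    ...   | inj₂ (s′ , le) = inj₂ (s′ , ℕ.m≤n⇒m≤1+n le)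

  module _ (d : ℕ) where

    deficit : (Fin m → Fin n) → ℕ
    deficit a = sum (map (λ v → d ∸ load a v) (allFin n))

    -- The first hyperedge of the path moves to the next vertex `w`. Either `w` had load below `d`
    -- and the deficit drops, or `w` becomes overloaded and takes over the role of `v`. The
    -- recursion is on the length bound `ℓ`, because a rerouted path is not a subterm of the given
    -- one.
    augment : ∀ ℓ ((a , _) : Assignment) {v u} → d < load a v → load a u < d →
              (s : Reach a v u) → length⋆ s ≤ ℓ →
              Σ Assignment λ (a′ , _) → deficit a′ < deficit a
    augment _ _ v>d u<d ε _ = contradiction (ℕ.<-trans v>d u<d) (ℕ.<-irrefl refl)
    augment (suc ℓ) (a , own) {v} {u} v>d u<d (_◅_ {j = w} (i , refl , w∈) s) (s≤s s≤ℓ)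
      = go
      where
      open Move a i w
      own′ : ∀ j → moved j ∈ˢ e j
      own′ j with j Fin.≟ i
      ... | yes refl = subst (_∈ˢ e i) (sym moved-at) w∈
      ... | no  j≢i  = subst (_∈ˢ e j) (sym (moved-off j≢i)) (own j)
      deficit-≤ : ∀ x → d ∸ load moved x ≤ d ∸ load a x
      deficit-≤ x with x Fin.≟ a i
      ... | no  x≢ = ℕ.∸-monoʳ-≤ d (load-other x≢)
      -- The source had load above `d` and loses at most one hyperedge, so its deficit stays 0.
      ... | yes refl = ℕ.≤-trans
        (ℕ.≤-reflexive (ℕ.m≤n⇒m∸n≡0 (ℕ.≤-pred (ℕ.≤-trans v>d load-source)))) z≤n
      go : Σ Assignment λ (a′ , _) → deficit a′ < deficit a
      go with w Fin.≟ a i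
      -- A step from a vertex to itself is simply dropped.
      ... | yes eq = augment ℓ (a , own) v>d u<d (subst (λ x → Reach a x u) eq s)
                       (ℕ.≤-trans (ℕ.≤-reflexive (length-subst eq)) s≤ℓ)
        where
        length-subst : ∀ {x} (eq : w ≡ x) →
                       length⋆ (subst (λ x → Reach a x u) eq s) ≡ length⋆ s
        length-subst refl = refl
      ... | no w≢ with load a w ℕ.<? d
      ...   | yes w<d = (moved , own′) ,
        sum-map-< deficit-≤ (∈-allFin w) (∸-monoʳ-<-unbounded w<d (load-target w≢))
      ...   | no  w≮d with reroute s
      -- The rest of the path uses `i` again: nothing is moved, and the shorter path from the same
      -- overloaded vertex is followed.
      ...     | inj₂ (s′ , le) = augment ℓ (a , own) v>d u<d s′ (ℕ.≤-trans le s≤ℓ)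
      -- Here `w` had load at least `d`, so receiving `i` lifts it above `d`; `u` differs from `w`
      -- and stays below `d`.
      ...     | inj₁ (s′ , le)
        with a′ , lt ← augment ℓ (moved , own′) (ℕ.≤-<-trans (ℕ.≮⇒≥ w≮d) (load-target w≢))
                         (ℕ.≤-<-trans (load-nontarget λ { refl → w≮d u<d }) u<d)
                         s′ (ℕ.≤-trans le s≤ℓ)
        = a′ , ℕ.<-≤-trans lt (sum-map-≤ deficit-≤ (allFin n))

    Saturated : Set
    Saturated = Σ Assignment λ (a , _) →
      ∃ λ v → d < load a v × (∀ {u} → Reach a v u → d ≤ load a u)

    -- Descent on the deficit: if an overloaded vertex reaches one of load below `d`, `augment`
    -- lowers the deficit. The double negation avoids deciding reachability and suffices for
    -- refuting Berge-freeness.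
    ¬¬-saturated : d * n < m → Assignment → ¬ ¬ Saturated
    ¬¬-saturated dn<m a₀ ¬sat =
      <-rec (λ δ → ∀ a → deficit (proj₁ a) ≡ δ → ⊥) descend _ a₀ refl
      where
      descend : ∀ δ → (∀ {δ′} → δ′ < δ → ∀ a → deficit (proj₁ a) ≡ δ′ → ⊥) →
                ∀ a → deficit (proj₁ a) ≡ δ → ⊥
      descend _ rec (a , own) refl with overloaded a dn<m
      ... | v , v>d = ¬sat ((a , own) , v , v>d , λ s → ℕ.≮⇒≥ λ u<d →
        let a′ , lt = augment _ (a , own) v>d u<d s ℕ.≤-refl in rec lt a′ refl)

-- Trees

∷⊆∷∷ : ∀ {A : Set} {x y : A} {xs} → x ∷ xs ⊆ x ∷ y ∷ xs
∷⊆∷∷ (here p)  = here p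
∷⊆∷∷ (there p) = there (there p)

∷∷-swap : ∀ {A : Set} {x y : A} {xs} → x ∷ y ∷ xs ⊆ y ∷ x ∷ xs
∷∷-swap (here p)          = there (here p)
∷∷-swap (there (here p))  = here p
∷∷-swap (there (there p)) = there (there p)

module Trees {v} (G : Graph v) where
  open Graph G

  data Walk : Fin v → List (Fin v) → Fin v → Set where
    []  : ∀ {x} → Walk x [] x
    _∷_ : ∀ {x y z ys} → Adj x y → Walk y ys z → Walk x (y ∷ ys) z

  SimplePathIn : List (Fin v) → Fin v → Fin v → Set
  SimplePathIn D x y = ∃ λ xs → Walk x xs y × Unique (x ∷ xs) × x ∷ xs ⊆ D

  suffix : ∀ {D x y ys z} → Walk y ys z → Unique (y ∷ ys) → y ∷ ys ⊆ D →
           x ∈ y ∷ ys → SimplePathIn D x z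
  suffix w       u       ⊆D (here refl) = _ , w , u , ⊆D
  suffix (_ ∷ w) (_ ∷ u) ⊆D (there x∈)  = suffix w u (⊆D ∘ there) x∈

  AdjIn : List (Fin v) → Fin v → Fin v → Set
  AdjIn D x y = Adj x y × x ∈ D × y ∈ D

  AdjIn-weaken : ∀ {z w D x y} → AdjIn (z ∷ D) x y → AdjIn (z ∷ w ∷ D) x y
  AdjIn-weaken (adj , x∈ , y∈) = adj , ∷⊆∷∷ x∈ , ∷⊆∷∷ y∈

  eraseLoops : ∀ {D x y} → y ∈ D → Star (AdjIn D) x y → SimplePathIn D x y
  eraseLoops y∈ ε = [] , [] , [] ∷ [] , λ { (here refl) → y∈ }
  eraseLoops {D} {x} y∈ (_◅_ {j = z} (adj , x∈ , _) s)
    with zs , w , u , ⊆D ← eraseLoops y∈ s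
    with x ∈? (z ∷ zs)
  ... | yes x∈zs = suffix w u ⊆D x∈zs
  ... | no  x∉zs = z ∷ zs , adj ∷ w , unique-∷ x∉zs u ,
                   λ { (here refl) → x∈ ; (there p) → ⊆D p }

  walk-step : ∀ {x xs y} → Walk x xs y → ∀ i →
              Adj (lookup (x ∷ xs) (inject₁ i)) (lookup xs i)
  walk-step (adj ∷ _) zero    = adj
  walk-step (_ ∷ w)   (suc i) = walk-step w i

  walk-end : ∀ {x xs y} → Walk x xs y → lookup (x ∷ xs) (fromℕ (length xs)) ≡ y
  walk-end []      = refl
  walk-end (_ ∷ w) = walk-end w

  -- A simple path from `p` to `q` inside `D` avoids `w`, so `w` closes it to a cycle; `p ≢ q` makes
  -- the cycle long enough.
  twoNeighbours⇒cycle : ∀ {D w p q} → w ∉ D → p ∈ D → q ∈ D → p ≢ q →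
    Adj w p → Adj q w → Star (AdjIn D) p q → Cycle G
  twoNeighbours⇒cycle {w = w} {p} w∉ p∈ q∈ p≢q wp qw s with eraseLoops q∈ s
  ... | [] , [] , _ = contradiction refl p≢q
  ... | x ∷ xs , walk , u , ⊆D = record
    { 2≤ℓ      = s≤s (s≤s z≤n)
    ; c        = lookup (w ∷ p ∷ x ∷ xs)
    ; distinct = lookup-injective (unique-∷ (w∉ ∘ ⊆D) u)
    ; step     = walk-step (wp ∷ walk)
    ; close    = subst (λ y → Adj y w) (sym (walk-end walk)) qw
    }

  -- C lists the non-root vertices placed so far, the latest first.
  data Order (x₀ : Fin v) (par : Fin v → Fin v) : List (Fin v) → Set where
    []    : Order x₀ par []
    place : ∀ {w C} → w ∉ x₀ ∷ C → par w ∈ x₀ ∷ C → Adj (par w) w →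
            Order x₀ par C → Order x₀ par (w ∷ C)

  Order-cong : ∀ {x₀ par par′ C} → (∀ {x} → x ∈ C → par x ≡ par′ x) →
               Order x₀ par C → Order x₀ par′ C
  Order-cong eq [] = []
  Order-cong eq (place {w} w∉ par∈ adj o) = place w∉
    (subst (_∈ _) (eq (here refl)) par∈)
    (subst (λ p → Adj p w) (eq (here refl)) adj) (Order-cong (eq ∘ there) o)

  exitStep : ∀ {D x y} → x ∈ D → y ∉ D → Star Adj x y →
             ∃ λ p → ∃ λ w → p ∈ D × w ∉ D × Adj p w
  exitStep x∈ y∉ ε = contradiction x∈ y∉
  exitStep {D} {x} x∈ y∉ (_◅_ {j = z} adj s) with z ∈? D
  ... | yes z∈ = exitStep z∈ y∉ s
  ... | no  z∉ = x , z , x∈ , z∉ , adj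

  -- By connectedness some edge leaves the set placed so far; its outer end is placed next, with its
  -- inner end as parent. Changing `par` there leaves the earlier parents intact.
  order : Connected G → ∀ x₀ j → j < v →
          ∃ λ par → ∃ λ C → Order x₀ par C × length C ≡ j
  order conn x₀ zero    _ = id , [] , [] , refl
  order conn x₀ (suc j) j<v
    with par , C , o , refl ← order conn x₀ j (ℕ.<-trans (ℕ.n<1+n j) j<v)
    with z , _ , z∉ ← fresh {ys = x₀ ∷ C} (Unique.allFin⁺ v)
                        (ℕ.≤-trans j<v (ℕ.≤-reflexive (sym (List.length-tabulate (id {A = Fin v})))))
    with p , w , p∈ , w∉ , adj ← exitStep (here refl) z∉ (conn x₀ z)
    = par′ , w ∷ C , place w∉ (subst (_∈ x₀ ∷ C) (sym par′w) p∈)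
                              (subst (λ y → Adj y w) (sym par′w) adj)
                              (Order-cong old o) , refl
    where
    par′ : Fin v → Fin v
    par′ = updateAt par w (const p)
    par′w : par′ w ≡ p
    par′w = updateAt-updates w par
    old : ∀ {x} → x ∈ C → par x ≡ par′ x
    old x∈ = sym (updateAt-minimal _ w par λ { refl → w∉ (there x∈) })

  module _ {x₀ : Fin v} {par : Fin v → Fin v} where

    order-unique : ∀ {C} → Order x₀ par C → Unique (x₀ ∷ C)
    order-unique [] = [] ∷ []
    order-unique (place w∉ _ _ o) with order-unique o
    ... | x₀∉ ∷ u = ((λ { refl → w∉ (here refl) }) ∷ x₀∉) ∷ unique-∷ (w∉ ∘ there) u

    order-covers : ∀ {C} → Order x₀ par C → v ≤ length (x₀ ∷ C) → ∀ x → x ∈ x₀ ∷ C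
    order-covers {C} o v≤ x with x ∈? (x₀ ∷ C)
    ... | yes x∈ = x∈
    ... | no  x∉ = contradiction
      (unique-⊆⇒length≤ {ys = allFin v} (unique-∷ x∉ (order-unique o)) (λ {y} _ → ∈-allFin y))
      (ℕ.<⇒≱ (s≤s (ℕ.≤-trans (ℕ.≤-reflexive (List.length-tabulate (id {A = Fin v}))) v≤)))

    par-∈ : ∀ {C} → Order x₀ par C → ∀ {y} → y ∈ C → par y ∈ x₀ ∷ C
    par-∈ (place _ par∈ _ o) (here refl) = ∷⊆∷∷ par∈
    par-∈ (place _ _ _ o)    (there y∈)  = ∷⊆∷∷ (par-∈ o y∈)

    par-adj : ∀ {C} → Order x₀ par C → ∀ {y} → y ∈ C → Adj (par y) y
    par-adj (place _ _ adj _) (here refl) = adj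
    par-adj (place _ _ _ o)   (there y∈)  = par-adj o y∈

    -- A parent is always placed before its child.
    par-asym : ∀ {C} → Order x₀ par C → ∀ {x y} → x ∈ C → y ∈ C →
                  par x ≡ y → par y ≢ x
    par-asym (place w∉ par∈ _ o) (here refl) (here refl) eq _ =
      w∉ (subst (_∈ _) eq par∈)
    par-asym (place w∉ par∈ _ o) (here refl) (there y∈) _ eq =
      w∉ (subst (_∈ _) eq (par-∈ o y∈))
    par-asym (place w∉ par∈ _ o) (there x∈) (here refl) eq _ =
      w∉ (subst (_∈ _) eq (par-∈ o x∈))
    par-asym (place _ _ _ o) (there x∈) (there y∈) = par-asym o x∈ y∈

    rootChild : ∀ {C} → Order x₀ par C → 0 < length C → ∃ λ y → y ∈ C × par y ≡ x₀
    rootChild (place {w} _ (here eq) _ []) _ = w , here refl , eq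
    rootChild (place _ _ _ o@(place _ _ _ _)) _
      with y , y∈ , eq ← rootChild o (s≤s z≤n) = y , there y∈ , eq

    fromRoot : ∀ {C} → Order x₀ par C → ∀ {y} → y ∈ x₀ ∷ C → Star (AdjIn (x₀ ∷ C)) x₀ y
    fromRoot o (here refl) = ε
    fromRoot (place w∉ par∈ adj o) (there (here refl)) =
      Star.map AdjIn-weaken (fromRoot o par∈) ◅◅ (adj , ∷⊆∷∷ par∈ , there (here refl)) ◅ ε
    fromRoot (place w∉ par∈ adj o) (there (there y∈)) =
      Star.map AdjIn-weaken (fromRoot o (there y∈))

    joined : ∀ {C} → Order x₀ par C → ∀ {x y} → x ∈ x₀ ∷ C → y ∈ x₀ ∷ C →
             Star (AdjIn (x₀ ∷ C)) x y
    joined o x∈ y∈ = Star.reverse (λ (a , p , q) → symm a , q , p) (fromRoot o x∈)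
                     ◅◅ fromRoot o y∈

    -- The vertex placed last has no earlier neighbour besides its parent: the vertices placed
    -- before it are connected among themselves, so a second neighbour would give a cycle.
    adj⇒par : ¬ Cycle G → ∀ {C} → Order x₀ par C →
              ∀ {x y} → x ∈ x₀ ∷ C → y ∈ x₀ ∷ C → Adj x y →
              (x ∈ C × par x ≡ y) ⊎ (y ∈ C × par y ≡ x)
    adj⇒par acyc [] (here refl) (here refl) adj = contradiction adj irrefl
    adj⇒par acyc (place {w} {C} w∉ par∈ par~w o) = go
      where
      D = x₀ ∷ C
      back : ∀ {x} → x ∈ x₀ ∷ w ∷ C → x ≡ w ⊎ x ∈ D
      back (here p)          = inj₂ (here p)
      back (there (here p))  = inj₁ p
      back (there (there p)) = inj₂ (there p)
      onlyPar : ∀ {y} → y ∈ D → Adj y w → par w ≡ y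
      onlyPar {y} y∈ y~w with par w Fin.≟ y
      ... | yes eq = eq
      ... | no  ne = ⊥-elim (acyc
        (twoNeighbours⇒cycle w∉ par∈ y∈ ne (symm par~w) y~w (joined o par∈ y∈)))
      go : ∀ {x y} → x ∈ x₀ ∷ w ∷ C → y ∈ x₀ ∷ w ∷ C → Adj x y →
           (x ∈ w ∷ C × par x ≡ y) ⊎ (y ∈ w ∷ C × par y ≡ x)
      go x∈ y∈ adj with back x∈ | back y∈
      ... | inj₁ refl | inj₁ refl = contradiction adj irrefl
      ... | inj₁ refl | inj₂ y∈D  = inj₁ (here refl , onlyPar y∈D (symm adj))
      ... | inj₂ x∈D  | inj₁ refl = inj₂ (here refl , onlyPar x∈D adj)
      ... | inj₂ x∈D  | inj₂ y∈D with adj⇒par acyc o x∈D y∈D adj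
      ...   | inj₁ (p , eq) = inj₁ (there p , eq)
      ...   | inj₂ (p , eq) = inj₂ (there p , eq)

-- Greedy embedding

infixl 6 _[_≔_]

_[_≔_] : ∀ {n} {A : Set} → (Fin n → A) → Fin n → A → Fin n → A
f [ w ≔ z ] = updateAt f w (const z)

module _ {n : ℕ} {A : Set} where

  ≔-new : ∀ (f : Fin n → A) w {z} → (f [ w ≔ z ]) w ≡ z
  ≔-new f w = updateAt-updates w f

  ≔-old : ∀ (f : Fin n → A) {w z x} → x ≢ w → (f [ w ≔ z ]) x ≡ f x
  ≔-old f x≢w = updateAt-minimal _ _ f x≢w

  -- Partial embeddings are total functions whose values matter only on the placed vertices, hence
  -- injectivity relative to a list.
  InjectiveOn : List (Fin n) → (Fin n → A) → Set
  InjectiveOn xs f = ∀ {x y} → x ∈ xs → y ∈ xs → f x ≡ f y → x ≡ y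

  ≔-injectiveOn : ∀ {f xs w z} → w ∉ xs → z ∉ map f xs → InjectiveOn xs f →
                  InjectiveOn (w ∷ xs) (f [ w ≔ z ])
  ≔-injectiveOn {f} {xs} {w} {z} w∉ z∉ inj = go
    where
    apart : ∀ {x} → x ∈ xs → x ≢ w
    apart x∈ refl = w∉ x∈
    new≢old : ∀ {x} → x ∈ xs → (f [ w ≔ z ]) w ≢ (f [ w ≔ z ]) x
    new≢old x∈ eq = z∉ (subst (_∈ map f xs)
      (trans (sym (≔-old f (apart x∈))) (trans (sym eq) (≔-new f w))) (∈-map⁺ f x∈))
    go : InjectiveOn (w ∷ xs) (f [ w ≔ z ])
    go (here refl) (here refl) eq = refl
    go (here refl) (there y∈)  eq = contradiction eq (new≢old y∈)
    go (there x∈)  (here refl) eq = contradiction (sym eq) (new≢old x∈)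
    go (there x∈)  (there y∈)  eq =
      inj x∈ y∈ (trans (sym (≔-old f (apart x∈))) (trans eq (≔-old f (apart y∈))))

module Embedding {v n m : ℕ} (G : Graph v) (e : Fin m → Subset n)
                 (x₀ : Fin v) (par : Fin v → Fin v) where
  open Graph G
  open Trees G

  -- The tree edge between y and par y is represented by the hyperedge g y.
  record Embeds (C : List (Fin v)) (φ : Fin v → Fin n) (g : Fin v → Fin m) : Set where
    field
      φ-inj : InjectiveOn (x₀ ∷ C) φ
      g-inj : InjectiveOn C g
      ends  : ∀ {y} → y ∈ C → φ (par y) ∈ˢ e (g y) × φ y ∈ˢ e (g y)

  extend : ∀ {w C φ g i z} → Order x₀ par (w ∷ C) → Embeds C φ g →
           i ∉ map g C → z ∉ map φ (x₀ ∷ C) → φ (par w) ∈ˢ e i → z ∈ˢ e i →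
           Embeds (w ∷ C) (φ [ w ≔ z ]) (g [ w ≔ i ])
  extend {w} {C} {φ} {g} {i} {z} (place w∉ par∈ adj o) emb i∉ z∉ p∈ z∈ = record
    { φ-inj = λ x∈ y∈ → ≔-injectiveOn w∉ z∉ φ-inj (∷∷-swap x∈) (∷∷-swap y∈)
    ; g-inj = ≔-injectiveOn (w∉ ∘ there) i∉ g-inj
    ; ends  = λ
      { (here refl) →
          subst (φ′ (par w) ∈ˢ_) (cong e (sym (≔-new g w)))
            (subst (_∈ˢ e i) (sym (≔-old φ (apart par∈))) p∈) ,
          subst (φ′ w ∈ˢ_) (cong e (sym (≔-new g w)))
            (subst (_∈ˢ e i) (sym (≔-new φ w)) z∈)
      ; {y} (there y∈) →
          subst (φ′ (par y) ∈ˢ_) (cong e (sym (≔-old g (apart (there y∈)))))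
            (subst (_∈ˢ e (g y)) (sym (≔-old φ (apart (par-∈ o y∈)))) (proj₁ (ends y∈))) ,
          subst (φ′ y ∈ˢ_) (cong e (sym (≔-old g (apart (there y∈)))))
            (subst (_∈ˢ e (g y)) (sym (≔-old φ (apart (there y∈)))) (proj₂ (ends y∈)))
      }
    }
    where
    open Embeds emb
    φ′ = φ [ w ≔ z ]
    apart : ∀ {x} → x ∈ x₀ ∷ C → x ≢ w
    apart x∈ refl = w∉ x∈

  -- A hyperedge `i` containing all used vertices can represent any tree edge; giving it the edge of
  -- `c` releases `g c`.
  swap : ∀ {C φ g c i} → Order x₀ par C → Embeds C φ g → c ∈ C → i ∉ map g C →
         (∀ {y} → y ∈ x₀ ∷ C → φ y ∈ˢ e i) →
         Embeds C φ (g [ c ≔ i ]) × g c ∉ map (g [ c ≔ i ]) C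
  swap {C} {φ} {g} {c} {i} o emb c∈ i∉ all∈ = record
    { φ-inj = φ-inj ; g-inj = inj′ ; ends = ends′ } , gc∉
    where
    open Embeds emb
    g′ = g [ c ≔ i ]
    i≢g : ∀ {y} → y ∈ C → i ≢ g y
    i≢g y∈ refl = i∉ (∈-map⁺ g y∈)
    inj′ : InjectiveOn C g′
    inj′ {x} {y} x∈ y∈ eq with x Fin.≟ c | y Fin.≟ c
    ... | yes refl | yes refl = refl
    ... | yes refl | no  y≢c  = contradiction
      (trans (sym (≔-new g c)) (trans eq (≔-old g y≢c))) (i≢g y∈)
    ... | no  x≢c  | yes refl = contradiction
      (trans (sym (≔-new g c)) (trans (sym eq) (≔-old g x≢c))) (i≢g x∈)
    ... | no  x≢c  | no  y≢c  =
      g-inj x∈ y∈ (trans (sym (≔-old g x≢c)) (trans eq (≔-old g y≢c)))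
    ends′ : ∀ {y} → y ∈ C → φ (par y) ∈ˢ e (g′ y) × φ y ∈ˢ e (g′ y)
    ends′ {y} y∈ with y Fin.≟ c
    ... | yes refl = subst (λ j → φ (par y) ∈ˢ e j × φ y ∈ˢ e j) (sym (≔-new g c))
                       (all∈ (par-∈ o y∈) , all∈ (there y∈))
    ... | no  y≢c  = subst (λ j → φ (par y) ∈ˢ e j × φ y ∈ˢ e j) (sym (≔-old g y≢c))
                       (ends y∈)
    gc∉ : g c ∉ map g′ C
    gc∉ p with y , y∈ , eq ← ∈-map⁻ g′ p with y Fin.≟ c
    ... | yes refl = i≢g y∈ (sym (trans eq (≔-new g c)))
    ... | no  y≢c  = y≢c (sym (g-inj c∈ y∈ (trans eq (≔-old g y≢c))))

  embedsRoot : ∀ u i → Embeds [] (const u) (const i)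
  embedsRoot u i = record
    { φ-inj = λ { (here refl) (here refl) _ → refl }
    ; g-inj = λ () ; ends = λ () }

  open Assignments e

  module Greedily (a : Fin m → Fin n) (own : ∀ i → a i ∈ˢ e i) {d r : ℕ}
                  (uniform : ∀ i → ∣ e i ∣ ≡ r) (e-inj : ∀ {i j} → e i ≡ e j → i ≡ j)
                  (degree≤ : ∀ x → degree G x ≤ suc d) {u₀ : Fin n}
                  (u₀-load : d < load a u₀)
                  (saturated : ∀ {u} → Reach a u₀ u → d ≤ load a u) where

    -- By `owner`, the used hyperedges owned by an image correspond to children of its preimage. By
    -- `reach`, every image has load at least `d`; by `root`, the image of `x₀` has load above `d`,
    -- which compensates for its having no parent.
    record Greedy (C : List (Fin v)) (φ : Fin v → Fin n) (g : Fin v → Fin m) : Set where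
      field
        embeds : Embeds C φ g
        owner  : ∀ {y} → y ∈ C → a (g y) ≡ φ (par y)
        reach  : ∀ {y} → y ∈ x₀ ∷ C → Reach a u₀ (φ y)
        root   : φ x₀ ≡ u₀
      open Embeds embeds public

    -- The edges owned by φ (par w) that are in use belong to children of
    -- par w other than w, and these are fewer than the owned edges.
    freshEdge : ∀ {w C φ g} → Order x₀ par (w ∷ C) → Greedy C φ g →
                ∃ λ i → a i ≡ φ (par w) × i ∉ map g C
    freshEdge {w} {C} {φ} {g} (place w∉ par∈ adj o) gr = split par∈
      where
      open Greedy gr
      p = par w
      N = filter (adj? p) (allFin v)
      N₁ = filter (λ y → ¬? (y Fin.≟ w)) N
      N₂ = filter (λ y → ¬? (y Fin.≟ par p)) N₁

      N₁<deg : length N₁ < degree G p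
      N₁<deg = List.filter-notAll _ N
        (lose (∈-filter⁺ (adj? p) (∈-allFin w) adj) (λ ne → ne refl))

      child∈N₁ : ∀ {y} → y ∈ C → par y ≡ p → y ∈ N₁
      child∈N₁ {y} y∈ eq = ∈-filter⁺ _
        (∈-filter⁺ (adj? p) (∈-allFin y) (subst (λ q → Adj q y) eq (par-adj o y∈)))
        (λ { refl → w∉ (there y∈) })

      -- If the chosen `i` were `g y`, then `owner` and injectivity of `φ` would make `y` a child of
      -- `p`, so `i` would lie in `map g N′`.
      pick : ∀ N′ → length N′ < load a (φ p) → (∀ {y} → y ∈ C → par y ≡ p → y ∈ N′) →
             ∃ λ i → a i ≡ φ p × i ∉ map g C
      pick N′ lt children
        with i , i∈ , i∉ ← fresh {ys = map g N′} (owned-unique a (φ p))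
                             (subst (_< load a (φ p)) (sym (List.length-map g N′)) lt)
        = i , ∈-owned⁻ a i∈ , unused
        where
        unused : i ∉ map g C
        unused q with y , y∈ , refl ← ∈-map⁻ g q =
          i∉ (∈-map⁺ g (children y∈
            (φ-inj (par-∈ o y∈) par∈ (trans (sym (owner y∈)) (∈-owned⁻ a i∈)))))

      split : p ∈ x₀ ∷ C → ∃ λ i → a i ≡ φ p × i ∉ map g C
      -- At the root only `w` is discarded: at most `d` neighbours remain, against a load above `d`.
      split (here p≡x₀) = pick N₁
        (ℕ.<-≤-trans N₁<deg (ℕ.≤-trans (degree≤ p)
          (subst (λ u → suc d ≤ load a u) (sym (trans (cong φ p≡x₀) root)) u₀-load)))
        child∈N₁
      -- Elsewhere the parent of `p` is discarded as well: fewer than `d` neighbours remain, against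
      -- a load of at least `d`.
      split (there p∈) = pick N₂
        (ℕ.<-≤-trans (ℕ.<-≤-trans N₂<N₁ (ℕ.≤-pred (ℕ.≤-trans N₁<deg (degree≤ p))))
          (saturated (reach par∈)))
        (λ y∈ eq → ∈-filter⁺ _ (child∈N₁ y∈ eq)
          (λ y≡ → par-asym o y∈ p∈ eq (sym y≡)))
        where
        N₂<N₁ : length N₂ < length N₁
        N₂<N₁ = List.filter-notAll _ N₁ (lose
          (∈-filter⁺ _ (∈-filter⁺ (adj? p) (∈-allFin (par p)) (symm (par-adj o p∈)))
            (λ eq → w∉ (subst (_∈ x₀ ∷ C) eq (par-∈ o p∈))))
          (λ ne → ne refl))

    grow : ∀ {w C φ g} → Order x₀ par (w ∷ C) → Greedy C φ g → length (x₀ ∷ C) < r →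
           ∃ λ φ′ → ∃ λ g′ → Greedy (w ∷ C) φ′ g′
    grow {w} {C} {φ} {g} O@(place w∉ par∈ adj o) gr lt
      with i , ai≡ , i∉ ← freshEdge O gr
      with z , z∈ , z∉ ← freshElement (e i) {map φ (x₀ ∷ C)}
             (subst (length (map φ (x₀ ∷ C)) <_) (sym (uniform i))
               (subst (_< r) (sym (List.length-map φ (x₀ ∷ C))) lt))
      = φ′ , g′ , record
      { embeds = extend O embeds i∉ z∉ (subst (_∈ˢ e i) ai≡ (own i)) z∈
      ; owner  = λ
        { (here refl) → trans (cong a (≔-new g w)) (trans ai≡ (sym (≔-old φ (apart par∈))))
        ; (there y∈)  → trans (cong a (≔-old g (apart (there y∈))))
                          (trans (owner y∈) (sym (≔-old φ (apart (par-∈ o y∈))))) }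
      ; reach  = λ y∈ → reach′ (∷∷-swap y∈)
      ; root   = trans (≔-old φ (apart (here refl))) root
      }
      where
      open Greedy gr
      φ′ = φ [ w ≔ z ]
      g′ = g [ w ≔ i ]
      apart : ∀ {x} → x ∈ x₀ ∷ C → x ≢ w
      apart x∈ refl = w∉ x∈
      reach′ : ∀ {y} → y ∈ w ∷ x₀ ∷ C → Reach a u₀ (φ′ y)
      reach′ (here refl) = subst (Reach a u₀) (sym (≔-new φ w))
        (reach par∈ ◅◅ (i , ai≡ , z∈) ◅ ε)
      reach′ (there y∈)  = subst (Reach a u₀) (sym (≔-old φ (apart y∈))) (reach y∈)

    -- Each time a vertex is placed, fewer than `r` vertices are in use, so the chosen hyperedge has
    -- one to spare. The given hyperedge is the default value of `g`.
    greedy : Fin m → ∀ {C} → Order x₀ par C → length C < r →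
             ∃ λ φ → ∃ λ g → Greedy C φ g
    greedy i [] _ = const u₀ , const i , record
      { embeds = embedsRoot u₀ i
      ; owner = λ () ; reach = λ { (here refl) → ε } ; root = refl }
    greedy i O@(place _ _ _ o) lt
      with _ , _ , gr ← greedy i o (ℕ.<⇒≤ lt) = grow O gr lt

    -- If the hyperedge chosen for w is exactly the set of used vertices, it
    -- can replace another hyperedge through φ (par w), which then has a
    -- vertex to spare for w.
    embedLast : 2 ≤ r → ∀ {w C φ g} → Order x₀ par (w ∷ C) → Greedy C φ g →
                length (x₀ ∷ C) ≤ r → ∃ λ φ′ → ∃ λ g′ → Embeds (w ∷ C) φ′ g′
    embedLast 2≤r {w} {C} {φ} {g} O@(place w∉ par∈ adj o) gr le
      with i , ai≡ , i∉ ← freshEdge O gr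
      with Fin.any? (λ z → (z Subset.∈? e i) ×-dec ¬? (z ∈? map φ (x₀ ∷ C)))
    ... | yes (z , z∈ , z∉) = _ , _ ,
      extend O (Greedy.embeds gr) i∉ z∉ (subst (_∈ˢ e i) ai≡ (own i)) z∈
    ... | no ¬z = result
      where
      open Greedy gr
      e⊆ : ∀ {z} → z ∈ˢ e i → z ∈ map φ (x₀ ∷ C)
      e⊆ {z} z∈ with z ∈? map φ (x₀ ∷ C)
      ... | yes p = p
      ... | no  q = ⊥-elim (¬z (z , z∈ , q))

      -- All `r` vertices of `e i` are used and at most `r` vertices are in use, so the two sets
      -- coincide.
      exhausts : ∀ {u} → u ∈ map φ (x₀ ∷ C) → u ∈ˢ e i
      exhausts = covered⇒exhausts (e i)
        (ℕ.≤-trans (ℕ.≤-reflexive (List.length-map φ (x₀ ∷ C)))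
          (ℕ.≤-trans le (ℕ.≤-reflexive (sym (uniform i))))) e⊆

      -- The at least two vertices of `e i` are all in use, so the root is not the only placed
      -- vertex.
      0<C : 0 < length C
      0<C = ℕ.≤-pred (ℕ.≤-trans 2≤r (ℕ.≤-trans
        (ℕ.≤-reflexive (trans (sym (uniform i)) (sym (length-elements (e i)))))
        (ℕ.≤-trans (unique-⊆⇒length≤ (elements-unique (e i)) (e⊆ ∘ ∈-elements (e i)))
          (ℕ.≤-reflexive (List.length-map φ (x₀ ∷ C))))))

      -- At the root the edge to some child is taken, elsewhere the edge from `par w` to its own
      -- parent.
      anotherEdge : par w ∈ x₀ ∷ C → ∃ λ c → c ∈ C × φ (par w) ∈ˢ e (g c)
      anotherEdge (here eq) with c , c∈ , pc ← rootChild o 0<C =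
        c , c∈ , subst (λ x → φ x ∈ˢ e (g c)) (trans pc (sym eq)) (proj₁ (ends c∈))
      anotherEdge (there p∈) = par w , p∈ , proj₂ (ends p∈)

      result : ∃ λ φ′ → ∃ λ g′ → Embeds (w ∷ C) φ′ g′
      result
        with c , c∈ , p∈ ← anotherEdge par∈
        with emb′ , gc∉ ← swap o embeds c∈ i∉ (λ y∈ → exhausts (∈-map⁺ φ y∈))
        with z , z∈ , z∉ ← difference (e (g c)) (e i)
               (ℕ.≤-reflexive (trans (uniform i) (sym (uniform (g c)))))
               (λ eq → i∉ (subst (_∈ map g C) (e-inj eq) (∈-map⁺ g c∈)))
        = _ , _ , extend O emb′ gc∉ (z∉ ∘ exhausts) p∈ z∈

-- From tree embeddings to Berge copies

module _ {v} (G : Graph v) where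
  open Graph G

  edges-unique : Unique (edges G)
  edges-unique = Unique.filter⁺ _ (Unique.cartesianProduct⁺ (Unique.allFin⁺ v) (Unique.allFin⁺ v))

  edge-adj : ∀ j → let (x , y) = lookup (edges G) j in x Fin.< y × Adj x y
  edge-adj j = proj₂ (∈-filter⁻ (λ (x , y) → (x Fin.<? y) ×-dec adj? x y)
    {xs = cartesianProduct (allFin v) (allFin v)} (∈-lookup j))

  adj⇒edge : ∀ {x y} → Adj x y → 0 < length (edges G)
  adj⇒edge {x} {y} adj with Fin.<-cmp x y
  ... | tri< x<y _ _  =
    ∈-length (∈-filter⁺ _ (∈-cartesianProduct⁺ (∈-allFin x) (∈-allFin y)) (x<y , adj))
  ... | tri≈ _ refl _ = contradiction adj irrefl
  ... | tri> _ _ y<x  =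
    ∈-length (∈-filter⁺ _ (∈-cartesianProduct⁺ (∈-allFin y) (∈-allFin x)) (y<x , symm adj))

  degree≤maxDegree : ∀ x → degree G x ≤ maxDegree G
  degree≤maxDegree x = All.lookup (Extrema.xs≤max 0 (map (degree G) (allFin v)))
    (∈-map⁺ (degree G) (∈-allFin x))

-- Each tree edge goes to the hyperedge of its child end. This is injective because the child
-- determines the edge, the other end being its parent.
embeds⇒berge : ∀ {v n} (G : Graph v) (H : Hypergraph n) {x₀ par C φ g} →
  ¬ Cycle G → Trees.Order G x₀ par C → v ≤ length (x₀ ∷ C) →
  Embedding.Embeds G (lookup (hyperedges H)) x₀ par C φ g → BergeCopy G H
embeds⇒berge {v} G H {x₀} {par} {C} {φ} {g} acyc o v≤ emb = record
  { φ = φ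
  ; φ-injective = φ-inj (covered _) (covered _)
  ; f = g ∘ child
  ; f-injective = λ {i} {j} eq → lookup-injective (edges-unique G)
      (determined i j (g-inj (childOf∈ (oriented i)) (childOf∈ (oriented j)) eq))
  ; covers = λ i → childOf-covers (oriented i)
  }
  where
  open Graph G
  open Trees G
  open Embedding.Embeds emb
  covered = order-covers o v≤
  Ends : Fin v → Fin v → Set
  Ends x y = (x ∈ C × par x ≡ y) ⊎ (y ∈ C × par y ≡ x)
  oriented : ∀ j → let (x , y) = lookup (edges G) j in Ends x y
  oriented j = adj⇒par acyc o (covered _) (covered _) (proj₂ (edge-adj G j))
  childOf : ∀ {x y} → Ends x y → Fin v
  childOf {x} {y} (inj₁ _) = x
  childOf {x} {y} (inj₂ _) = y
  child : Fin (length (edges G)) → Fin v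
  child j = childOf (oriented j)
  childOf∈ : ∀ {x y} (p : Ends x y) → childOf p ∈ C
  childOf∈ (inj₁ (x∈ , _)) = x∈
  childOf∈ (inj₂ (y∈ , _)) = y∈
  same : ∀ {x y x′ y′} → x Fin.< y → x′ Fin.< y′ → (p : Ends x y) (q : Ends x′ y′) →
         childOf p ≡ childOf q → (x , y) ≡ (x′ , y′)
  same _ _ (inj₁ (_ , refl)) (inj₁ (_ , refl)) refl = refl
  same _ _ (inj₂ (_ , refl)) (inj₂ (_ , refl)) refl = refl
  -- With opposite orientations the same two ends would be increasing in both orders.
  same < >′ (inj₁ (_ , refl)) (inj₂ (_ , refl)) refl = contradiction >′ (ℕ.<-asym <)
  same < >′ (inj₂ (_ , refl)) (inj₁ (_ , refl)) refl = contradiction >′ (ℕ.<-asym <)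
  determined : ∀ i j → child i ≡ child j → lookup (edges G) i ≡ lookup (edges G) j
  determined i j = same (proj₁ (edge-adj G i)) (proj₁ (edge-adj G j)) (oriented i) (oriented j)
  inUnion : ∀ {n} {p : Subset n} {a b} → a ∈ˢ p → b ∈ˢ p → ⁅ a ⁆ ∪ ⁅ b ⁆ ⊆ˢ p
  inUnion {a = a} {b} a∈ b∈ z∈ with Subset.x∈p∪q⁻ ⁅ a ⁆ ⁅ b ⁆ z∈
  ... | inj₁ z∈a rewrite Subset.x∈⁅y⁆⇒x≡y a z∈a = a∈
  ... | inj₂ z∈b rewrite Subset.x∈⁅y⁆⇒x≡y b z∈b = b∈
  childOf-covers : ∀ {x y} (p : Ends x y) →
                   ⁅ φ x ⁆ ∪ ⁅ φ y ⁆ ⊆ˢ lookup (hyperedges H) (g (childOf p))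
  childOf-covers (inj₁ (x∈ , refl)) = inUnion (proj₂ (ends x∈)) (proj₁ (ends x∈))
  childOf-covers (inj₂ (y∈ , refl)) = inUnion (proj₁ (ends y∈)) (proj₂ (ends y∈))

-- The bound on the number of hyperedges

bergeFree-size : ∀ {k r n} → 1 ≤ k → 2 ≤ r → (T : Graph (suc k)) → IsTree T → k ≤ r →
  (H : Hypergraph n) → Uniform r H → BergeFree T H → size H ≤ (maxDegree T ∸ 1) * n
bergeFree-size {k} {r} {n} 1≤k 2≤r T tree k≤r H uniform free =
  -- The descent starts from an arbitrary choice of one vertex in each hyperedge.
  ℕ.≮⇒≥ λ dn<m → ¬¬-saturated d dn<m (proj₁ ∘ nonempty , proj₁ ∘ proj₂ ∘ nonempty)
    λ ((a , own) , _ , u₀-load , saturated) →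
      let par , C , o , ∣C∣≡k = order connected zero k ℕ.≤-refl
      in  embed a own u₀-load saturated (Fin.fromℕ< (ℕ.≤-<-trans z≤n dn<m)) o ∣C∣≡k
  where
  open IsTree tree
  open Trees T
  d = maxDegree T ∸ 1
  e = lookup (hyperedges H)
  open Assignments e

  ∣e∣≡r : ∀ i → ∣ e i ∣ ≡ r
  ∣e∣≡r i = All.lookup uniform (∈-lookup i)

  nonempty : ∀ i → ∃ λ x → x ∈ˢ e i × x ∉ []
  nonempty i = freshElement (e i)
    (subst (0 <_) (sym (∣e∣≡r i)) (ℕ.<-trans (s≤s z≤n) 2≤r))

  degree≤ : ∀ x → degree T x ≤ suc d
  -- This also covers maximum degree 0, where the subtraction in `d` truncates.
  degree≤ x = ℕ.≤-trans (degree≤maxDegree T x) (ℕ.m≤n+m∸n (maxDegree T) 1)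

  embed : ∀ a → (∀ i → a i ∈ˢ e i) → ∀ {u₀} → d < load a u₀ →
          (∀ {u} → Reach a u₀ u → d ≤ load a u) → Fin (size H) →
          ∀ {par C} → Order zero par C → length C ≡ k → ⊥
  embed _ _ _ _ _ [] 0≡k = contradiction (subst (1 ≤_) (sym 0≡k) 1≤k) λ ()
  embed a own u₀-load saturated i {par} O@(place _ _ _ o) ∣C∣≡k =
    -- All vertices but the last are placed greedily. Since one vertex of `C` is held back, `k ≤ r`
    -- gives both the strict bound for `greedy` and the weak one for `embedLast`.
    let _ , _ , gr  = greedy i o ∣C∣≤r
        _ , _ , emb = embedLast 2≤r O gr ∣C∣≤r
    in  free (embeds⇒berge T H acyclic O (s≤s (ℕ.≤-reflexive (sym ∣C∣≡k))) emb)
    where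
    ∣C∣≤r = ℕ.≤-trans (ℕ.≤-reflexive ∣C∣≡k) k≤r
    open Embedding T e zero par
    open Greedily a own ∣e∣≡r (lookup-injective (simple H)) degree≤ u₀-load saturated

tree-edge : ∀ {k} (T : Graph (suc k)) → 1 ≤ k → Connected T → 0 < length (edges T)
tree-edge {suc _} T _ conn with conn zero (suc zero)
... | adj ◅ _ = adj⇒edge T adj

theorem9 : (k r : ℕ) → 1 ≤ k → 2 ≤ r →
    (T : Graph (suc k)) → IsTree T → k ≤ r →
    (n : ℕ) → 1 ≤ n →
    ex r n T ≤ (maxDegree T ∸ 1) * n
theorem9 k r 1≤k 2≤r T tree k≤r n _
  -- As `T` has an edge, the empty hypergraph is admissible and `ex` is attained by an actual
  -- hypergraph.
  with H , ∣H∣≡ex , uniform , free ← ex-attained r n T (tree-edge T 1≤k (IsTree.connected tree))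
  = subst (_≤ (maxDegree T ∸ 1) * n) ∣H∣≡ex (bergeFree-size 1≤k 2≤r T tree k≤r H uniform free)
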